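{- Let $k\geq 2$ and $n\geq 2$ be integers. Then: (i) for an integer $r$ with $0\leq r\leq n$, the digraph $H_k^{r,r}(n-1)$ is Eulerian if and only if $r\in\{0,1,n-1,n\}$; (ii) $H_k^{r,r+1}(n-1)$ is Eulerian for every integer $r$ with $0\leq r<n$.
   Context: A $k$-ary $n$-tuple is an element of $\mathbb{Z}_k^n$, with entries identified with the integers $0,1,\dots,k-1$. The de Bruijn digraph $B_k(n-1)$ has vertex set $\mathbb{Z}_k^{n-1}$, and its edges are identified with the $k$-ary $n$-tuples: the $n$-tuple $(x_0,\dots,x_{n-1})$ is the edge from vertex $(x_0,\dots,x_{n-2})$ to vertex $(x_1,\dots,x_{n-1})$ (loops allowed). A subgraph "consisting of" a set of edges has exactly those edges, and its vertices are the vertices incident with at least one of them. A digraph is Eulerian if it is strongly connected (there is a directed path between any ordered pair of its vertices) and balanced (every vertex has in-degree equal to out-degree). The Hamming weight $w_h(\mathbf{a})$ of a $k$-ary $n$-tuple $\mathbf{a}=(a_0,\dots,a_{n-1})$ is the number of indices $i$ with $a_i\neq 0$. For integers $0\leq r\leq s\leq n$, $H_k^{r,s}(n-1)$ is the subgraph of $B_k(n-1)$ consisting of the edges corresponding to $n$-tuples $\mathbf{a}$ with $r\leq w_h(\mathbf{a})\leq s$. -}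

module Defs where

open import Data.Fin.Base using (Fin; toℕ)
import Data.Fin.Properties as Fin
open import Data.List.Base using (List; []; _∷_; allFin; cartesianProductWith; filter; length)
open import Data.List.Membership.Propositional using (_∈_)
open import Data.List.Membership.Propositional.Properties using (∈-allFin; ∈-cartesianProductWith⁺)
open import Data.List.Relation.Unary.Any using (here)
open import Data.List.Relation.Unary.All using ([])
open import Data.List.Relation.Unary.AllPairs using ([]; _∷_)
open import Data.List.Relation.Unary.Unique.Propositional using (Unique)
open import Data.List.Relation.Unary.Unique.Propositional.Properties using (allFin⁺; cartesianProductWith⁺)
open import Data.Nat.Base using (ℕ; zero; suc; _≤_)
open import Data.Nat.Properties using (_≟_; _≤?_)
open import Data.Product.Base using (∃-syntax; _×_)
open import Data.Sum.Base using (_⊎_)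
open import Data.Vec.Base using (Vec; []; _∷_; init; tail; count)
open import Data.Vec.Properties using (≡-dec; ∷-injective)
open import Relation.Binary.Construct.Closure.ReflexiveTransitive using (Star)
open import Relation.Binary.Definitions using (DecidableEquality)
open import Relation.Binary.PropositionalEquality using (_≡_; refl)
open import Relation.Nullary.Decidable using (¬?; _×-dec_)
open import Relation.Unary using (Pred; Decidable)
open import Level using (0ℓ)

Tuple : ℕ → ℕ → Set
Tuple k n = Vec (Fin k) n

_≟ᵗ_ : ∀ {k n} → DecidableEquality (Tuple k n)
_≟ᵗ_ = ≡-dec Fin._≟_

tuples : ∀ k n → List (Tuple k n)
tuples k zero    = [] ∷ []
tuples k (suc n) = cartesianProductWith _∷_ (allFin k) (tuples k n)

-- Every tuple is listed exactly once, so that filtering `tuples` and taking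
-- lengths computes cardinalities.
tuples-complete : ∀ {k n} (a : Tuple k n) → a ∈ tuples k n
tuples-complete []      = here refl
tuples-complete (x ∷ a) = ∈-cartesianProductWith⁺ _∷_ (∈-allFin x) (tuples-complete a)

tuples-unique : ∀ k n → Unique (tuples k n)
tuples-unique k zero    = [] ∷ []
tuples-unique k (suc n) =
  cartesianProductWith⁺ _∷_ ∷-injective (allFin⁺ k) (tuples-unique k n)

-- The de Bruijn digraph B_k(m): vertices are m-tuples and edges (m+1)-tuples.
module _ {k m : ℕ} where

  source : Tuple k (suc m) → Tuple k m
  source = init

  target : Tuple k (suc m) → Tuple k m
  target = tail

-- A subgraph of B_k(m) consisting of a (decidable) set of edges.
record Subgraph (k m : ℕ) : Set₁ where
  field
    IsEdge  : Pred (Tuple k (suc m)) 0ℓ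
    isEdge? : Decidable IsEdge

  IsVertex : Pred (Tuple k m) 0ℓ
  IsVertex v = ∃[ e ] (IsEdge e × (source e ≡ v ⊎ target e ≡ v))

  _⟶_ : Tuple k m → Tuple k m → Set
  u ⟶ v = ∃[ e ] (IsEdge e × source e ≡ u × target e ≡ v)

  inDegree : Tuple k m → ℕ
  inDegree v = length (filter (λ e → isEdge? e ×-dec (target e ≟ᵗ v)) (tuples k (suc m)))

  outDegree : Tuple k m → ℕ
  outDegree v = length (filter (λ e → isEdge? e ×-dec (source e ≟ᵗ v)) (tuples k (suc m)))

  -- Directed paths may have length zero.
  StronglyConnected : Set
  StronglyConnected = ∀ u v → IsVertex u → IsVertex v → Star _⟶_ u v

  Balanced : Set
  Balanced = ∀ v → IsVertex v → inDegree v ≡ outDegree v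

  Eulerian : Set
  Eulerian = StronglyConnected × Balanced

open Subgraph public using (Eulerian)

hammingWeight : ∀ {k n} → Tuple k n → ℕ
hammingWeight = count (λ x → ¬? (toℕ x ≟ 0))

-- H k r s m is H_k^{r,s}(m); its edges are (m+1)-tuples, so the digraph
-- attached to n-tuples (n ≥ 1) is H k r s (n ∸ 1).
H : (k r s m : ℕ) → Subgraph k m
H k r s m = record
  { IsEdge  = λ a → r ≤ hammingWeight a × hammingWeight a ≤ s
  ; isEdge? = λ a → (r ≤? hammingWeight a) ×-dec (hammingWeight a ≤? s)
  }

{-# OPTIONS --safe #-}
-- Rotating an edge e of the de Bruijn digraph gives an edge starting at the
-- target of e.  A set of edges closed under rotation is therefore a union of
-- closed walks: it is balanced, and reachability is symmetric.  Two edges that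
-- differ in one letter lie, after rotation, on edges with a common target, so
-- for strong connectivity it suffices to pass between any two edges by
-- rotations and single-letter changes without leaving the weight range.  For
-- weights in {r, r+1} the changes suffice; weight 0 (resp. n) is the same
-- window, truncated at the bottom (resp. the top), and weight 1 (resp. n-1) is
-- reduced to it by rotating the nonzero letter (resp. the zero) to the front.
-- For 2 ≤ r ≤ n-2 consecutive edges of weight r have, up to the choice of the
-- nonzero letters, the same cyclic word, and the number of cyclic occurrences
-- of "zero, nonzero" tells two such words apart.
module Submission where

open import Defs
open import Data.Bool.Base using (Bool; true; false)
open import Data.Fin.Base using (Fin; zero; suc)
open import Data.List.Base using (List; []; _∷_; [_]; _++_; map; filter)
open import Data.List.Membership.Propositional using (_∈_)
open import Data.List.Membership.Propositional.Properties using (∈-map⁺; ∈-map⁻; ∈-filter⁺; ∈-filter⁻)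
open import Data.List.Membership.Propositional.Properties.WithK using (unique∧set⇒bag)
open import Data.List.Properties using (++-assoc; ++-identityʳ; length-map; ∷-injective)
open import Data.List.Relation.Binary.BagAndSetEquality using (∼bag⇒↭)
open import Data.List.Relation.Binary.Permutation.Propositional.Properties using (↭-length)
open import Data.List.Relation.Unary.Unique.Propositional.Properties using (map⁺; filter⁺)
open import Data.Nat.Base using (ℕ; zero; suc; _+_; _∸_; _≤_; _<_; z≤n; s≤s)
open import Data.Nat.Properties using (+-comm; +-assoc; ≤-refl; ≤-reflexive; ≤-trans; ≤-antisym; ≤-pred; ≤∧≢⇒<; m≤n⇒m≤1+n; n≤0⇒n≡0; suc-injective; _≤?_; _≟_; ≰⇒>; 1+n≢n)
open import Data.Product.Base using (_×_; _,_; proj₂; ∃-syntax)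
open import Data.Sum.Base using (_⊎_; inj₁; inj₂)
open import Data.Vec.Base as Vec using (Vec; []; _∷_; _∷ʳ_; init; last; initLast; toList; replicate)
open import Data.Vec.Properties using (init-∷ʳ; ∷ʳ-injective; toList-∷ʳ; toList-injective; map-∷ʳ; count≤n; cast-is-id)
open import Function.Base using (_∘_)
open import Function.Bundles using (_⇔_; mk⇔)
open import Relation.Binary.Construct.Closure.ReflexiveTransitive as Star using (Star; ε; _◅_; _◅◅_)
open import Relation.Binary.PropositionalEquality using (_≡_; refl; sym; trans; cong; subst; module ≡-Reasoning)
open import Relation.Nullary using (¬_; yes; no; contradiction)
open import Relation.Nullary.Decidable using (_×-dec_)
open import Relation.Unary using (Pred)
open import Level using (0ℓ)

-- Rotation

module _ {A : Set} where

  rot : ∀ {n} → Vec A (suc n) → Vec A (suc n)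
  rot (x ∷ a) = a ∷ʳ x

  rot-injective : ∀ {n} {a b : Vec A (suc n)} → rot a ≡ rot b → a ≡ b
  rot-injective {a = x ∷ a} {y ∷ b} eq with refl , refl ← ∷ʳ-injective a b eq = refl

  init∷ʳlast : ∀ {n} (a : Vec A (suc n)) → init a ∷ʳ last a ≡ a
  init∷ʳlast a = sym (proj₂ (proj₂ (initLast a)))

  infix 4 _↻_
  _↻_ : ∀ {n} → Vec A (suc n) → Vec A (suc n) → Set
  _↻_ = Star (λ a b → rot a ≡ b)

  -- Each rotation moves the head of `xs` behind `ys`. Splitting as lists keeps sums of lengths out
  -- of the vector types.
  swap-↻ : ∀ {n} (xs ys : List A) (a b : Vec A (suc n)) →
           toList a ≡ xs ++ ys → toList b ≡ ys ++ xs → a ↻ b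
  swap-↻ [] ys a b p q = subst (a ↻_) (trans (sym (cast-is-id refl a)) a≈b) ε
    where a≈b = toList-injective refl a b (trans p (sym (trans q (++-identityʳ ys))))
  swap-↻ (x ∷ xs) ys (z ∷ a) b p q with refl , p′ ← ∷-injective p =
    refl ◅ swap-↻ xs (ys ++ [ x ]) (a ∷ʳ x) b
      (trans (toList-∷ʳ x a) (trans (cong (_++ [ x ]) p′) (++-assoc xs ys [ x ])))
      (trans q (sym (++-assoc ys [ x ] xs)))

  -- A rotation is undone by further forward rotations, one for each letter of the tail. This is
  -- what makes reachability symmetric.
  unrotate : ∀ {n} (a : Vec A (suc n)) → rot a ↻ a
  unrotate (x ∷ a) = swap-↻ (toList a) [ x ] (a ∷ʳ x) (x ∷ a) (toList-∷ʳ x a) refl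

  -- The index counts the rotations that bring the changed position to the front. The two letters
  -- there may coincide.
  data ChangeAt : ∀ {n} → ℕ → Vec A n → Vec A n → Set where
    here  : ∀ {n x y} {a : Vec A n} → ChangeAt 0 (x ∷ a) (y ∷ a)
    there : ∀ {n d z} {a b : Vec A n} → ChangeAt d a b → ChangeAt (suc d) (z ∷ a) (z ∷ b)

  ChangeAt-sym : ∀ {n d} {a b : Vec A n} → ChangeAt d a b → ChangeAt d b a
  ChangeAt-sym here      = here
  ChangeAt-sym (there c) = there (ChangeAt-sym c)

  ChangeAt-∷ʳ : ∀ {n d} {a b : Vec A n} z → ChangeAt d a b → ChangeAt d (a ∷ʳ z) (b ∷ʳ z)
  ChangeAt-∷ʳ z here      = here
  ChangeAt-∷ʳ z (there c) = there (ChangeAt-∷ʳ z c)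

  ChangeAt-front : ∀ {n} d {a b : Vec A (suc n)} → ChangeAt d a b →
                   ∃[ x ] ∃[ y ] ∃[ c ] (a ↻ x ∷ c × b ↻ y ∷ c)
  ChangeAt-front zero    here = _ , _ , _ , ε , ε
  ChangeAt-front (suc d) (there {z = z} c)
    with x , y , e , p , q ← ChangeAt-front d (ChangeAt-∷ʳ z c) =
    x , y , e , refl ◅ p , refl ◅ q

  Move : ∀ {n} → Pred (Vec A n) 0ℓ → Vec A n → Vec A n → Set
  Move P a b = P a × P b × ∃[ d ] ChangeAt d a b

  Move-sym : ∀ {n} {P : Pred (Vec A n) 0ℓ} {a b} → Move P a b → Move P b a
  Move-sym (p , q , d , c) = q , p , d , ChangeAt-sym c

  Move-map : ∀ {n} {P Q : Pred (Vec A n) 0ℓ} → (∀ a → P a → Q a) →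
             ∀ {a b} → Move P a b → Move Q a b
  Move-map f (p , q , dc) = f _ p , f _ q , dc

  Moves-∷ : ∀ {n} {P : Pred (Vec A n) 0ℓ} {Q : Pred (Vec A (suc n)) 0ℓ} z →
            (∀ {a} → P a → Q (z ∷ a)) → ∀ {a b} → Star (Move P) a b → Star (Move Q) (z ∷ a) (z ∷ b)
  Moves-∷ z f = Star.gmap (z ∷_) (λ (p , q , d , c) → f p , f q , suc d , there c)

-- Rotation-closed subgraphs

module RotationClosed {k m : ℕ} (G : Subgraph k m)
                      (closed : ∀ e → Subgraph.IsEdge G e → Subgraph.IsEdge G (rot e)) where

  open Subgraph G

  ↻-closed : ∀ {e f} → e ↻ f → IsEdge e → IsEdge f
  ↻-closed ε          p = p
  ↻-closed (refl ◅ s) p = ↻-closed s (closed _ p)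

  source-rot : ∀ (e : Tuple k (suc m)) → source (rot e) ≡ target e
  source-rot (x ∷ a) = init-∷ʳ x a

  infix 4 _~_
  -- Edges are compared by their targets, so `x ∷ c` and `y ∷ c` are joined by the empty path.
  _~_ : Tuple k (suc m) → Tuple k (suc m) → Set
  e ~ f = Star _⟶_ (target e) (target f)

  ↻⇒~ : ∀ {e f} → IsEdge e → e ↻ f → e ~ f
  ↻⇒~ p ε                  = ε
  ↻⇒~ {e} p (refl ◅ s)     = (rot e , closed e p , source-rot e , refl) ◅ ↻⇒~ (closed e p) s

  ↻⇒~˘ : ∀ {e f} → IsEdge e → e ↻ f → f ~ e
  ↻⇒~˘ p ε              = ε
  ↻⇒~˘ {e} p (refl ◅ s) = ↻⇒~˘ (closed e p) s ◅◅ ↻⇒~ (closed e p) (unrotate e)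

  Move⇒~ : ∀ {e f} → Move IsEdge e f → e ~ f
  Move⇒~ (p , q , d , c) with _ , _ , _ , s , t ← ChangeAt-front d c = ↻⇒~ p s ◅◅ ↻⇒~˘ q t

  Moves⇒~ : ∀ {e f} → Star (Move IsEdge) e f → e ~ f
  Moves⇒~ = Star.kleisliStar target Move⇒~

  source⟶target : ∀ {e} → IsEdge e → Star _⟶_ (source e) (target e)
  source⟶target {e} p = (e , p , refl , refl) ◅ ε

  target⟶source : ∀ e → IsEdge e → Star _⟶_ (target e) (source e)
  -- `last e ∷ init e` precedes `e` in its rotation cycle, and its target is `source e`.
  target⟶source e p = ↻⇒~ p (subst (_↻ last e ∷ init e) (init∷ʳlast e) (unrotate (last e ∷ init e)))

  stronglyConnected : (∀ e f → IsEdge e → IsEdge f → e ~ f) → StronglyConnected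
  stronglyConnected conn u v (e , p , eu) (f , q , fv) = toTarget eu ◅◅ conn e f p q ◅◅ fromTarget fv
    where
    toTarget : source e ≡ u ⊎ target e ≡ u → Star _⟶_ u (target e)
    toTarget (inj₁ refl) = source⟶target p
    toTarget (inj₂ refl) = ε
    fromTarget : source f ≡ v ⊎ target f ≡ v → Star _⟶_ (target f) v
    fromTarget (inj₁ refl) = target⟶source f q
    fromTarget (inj₂ refl) = ε

  -- Rotation maps the edges into `v` bijectively onto the edges out of `v`. Both lists are free of
  -- duplicates, so equal membership makes them permutations of each other.
  balanced : Balanced
  balanced v _ = trans (sym (length-map rot ins))
    (↭-length (∼bag⇒↭ (unique∧set⇒bag
      (map⁺ rot-injective (filter⁺ in? (tuples-unique k (suc m))))
      (filter⁺ out? (tuples-unique k (suc m)))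
      (mk⇔ to from))))
    where
    in?  = λ e → isEdge? e ×-dec (target e ≟ᵗ v)
    out? = λ e → isEdge? e ×-dec (source e ≟ᵗ v)
    ins  = filter in? (tuples k (suc m))
    outs = filter out? (tuples k (suc m))
    to : ∀ {f} → f ∈ map rot ins → f ∈ outs
    to f∈ with e , e∈ , refl ← ∈-map⁻ rot f∈
          with _ , p , refl ← ∈-filter⁻ in? {xs = tuples k (suc m)} e∈ =
      ∈-filter⁺ out? (tuples-complete (rot e)) (closed e p , source-rot e)
    from : ∀ {f} → f ∈ outs → f ∈ map rot ins
    from {f} f∈ with _ , p , refl ← ∈-filter⁻ out? {xs = tuples k (suc m)} f∈ =
      subst (_∈ map rot ins) (init∷ʳlast f)
        (∈-map⁺ rot (∈-filter⁺ in? (tuples-complete (last f ∷ init f))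
          (↻-closed (unrotate _) (subst IsEdge (sym (init∷ʳlast f)) p) , refl)))

-- Hamming weight

private
  weight : ∀ {k n} → Tuple k n → ℕ
  weight = hammingWeight

  variable
    k n : ℕ

weight-∷-cong : ∀ (x : Fin k) (a b : Tuple k n) → weight a ≡ weight b → weight (x ∷ a) ≡ weight (x ∷ b)
weight-∷-cong zero    a b eq = eq
weight-∷-cong (suc x) a b eq = cong suc eq

weight-tail≤ : ∀ (x : Fin k) (a : Tuple k n) → weight a ≤ weight (x ∷ a)
weight-tail≤ zero    a = ≤-refl
weight-tail≤ (suc x) a = m≤n⇒m≤1+n ≤-refl

weight-∷≤ : ∀ (x : Fin k) (a : Tuple k n) → weight (x ∷ a) ≤ suc (weight a)
weight-∷≤ zero    a = m≤n⇒m≤1+n ≤-refl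
weight-∷≤ (suc x) a = ≤-refl

weight≤n : ∀ (a : Tuple k n) → weight a ≤ n
weight≤n = count≤n _

weight-swap : ∀ (x y : Fin k) (a : Tuple k n) → weight (x ∷ y ∷ a) ≡ weight (y ∷ x ∷ a)
weight-swap zero    zero    a = refl
weight-swap zero    (suc y) a = refl
weight-swap (suc x) zero    a = refl
weight-swap (suc x) (suc y) a = refl

weight-∷ʳ : ∀ (x : Fin k) (a : Tuple k n) → weight (a ∷ʳ x) ≡ weight (x ∷ a)
weight-∷ʳ x []      = refl
weight-∷ʳ x (y ∷ a) = trans (weight-∷-cong y (a ∷ʳ x) (x ∷ a) (weight-∷ʳ x a)) (weight-swap y x a)

weight-↻ : ∀ {a b : Tuple k (suc n)} → a ↻ b → weight a ≡ weight b
weight-↻ ε                      = refl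
weight-↻ {a = x ∷ a} (refl ◅ s) = trans (sym (weight-∷ʳ x a)) (weight-↻ s)

lower : ∀ {w} (a : Tuple k n) → weight a ≡ suc w → ∃[ d ] ∃[ a′ ] (ChangeAt d a a′ × weight a′ ≡ w)
lower (suc x ∷ a) eq = 0 , zero ∷ a , here , suc-injective eq
lower (zero ∷ a)  eq with d , a′ , c , eq′ ← lower a eq = suc d , zero ∷ a′ , there c , eq′

raise : (a : Tuple (suc (suc k)) n) → weight a < n →
        ∃[ d ] ∃[ a′ ] (ChangeAt d a a′ × weight a′ ≡ suc (weight a))
raise (zero ∷ a)  lt = 0 , suc zero ∷ a , here , refl
raise (suc x ∷ a) (s≤s lt) with d , a′ , c , eq ← raise a lt = suc d , suc x ∷ a′ , there c , cong suc eq

-- Weight s-1 or s, phrased so that s = 0 is allowed; hence dropping a nonzero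
-- letter always lowers s by one, which drives the induction on the length.
record Window {k n : ℕ} (s : ℕ) (a : Tuple k n) : Set where
  constructor _,_
  field
    weight≤s   : weight a ≤ s
    s≤1+weight : s ≤ suc (weight a)

Window-zero : ∀ {s} {a : Tuple (suc k) n} → Window s a → Window s (zero ∷ a)
Window-zero (p , q) = p , q

Window-suc : ∀ {s} (x : Fin k) {a : Tuple (suc k) n} → Window s a → Window (suc s) (suc x ∷ a)
Window-suc x (p , q) = s≤s p , s≤s q

-- The leading zero can be replaced at once unless the rest already has the top weight `s`; then one
-- of its letters is lowered first, which stays in the window. The nonzero head of the other word
-- forces `s` to be positive.
insertNonzero : ∀ {s} (y : Fin k) (a b : Tuple (suc k) n) → Window s (zero ∷ a) → Window s (suc y ∷ b) →
  ∃[ s′ ] ∃[ a′ ] (s ≡ suc s′ × Window s′ a′ × Window s′ b × Star (Move (Window s)) (zero ∷ a) (suc y ∷ a′))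
insertNonzero {s = suc s} y a b wa@(p , q) (s≤s p′ , s≤s q′) with weight a ≤? s
... | yes a≤s = s , a , refl , w , (p′ , q′) , (wa , Window-suc y w , 0 , here) ◅ ε
  where w = a≤s , ≤-pred (m≤n⇒m≤1+n q)
... | no a≰s with d , a′ , c , eq ← lower a (≤-antisym p (≰⇒> a≰s)) =
  s , a′ , refl , w , (p′ , q′) ,
  (wa , w₀ , suc d , there c) ◅ (w₀ , Window-suc y w , 0 , here) ◅ ε
  where
  w  = ≤-reflexive eq , m≤n⇒m≤1+n (≤-reflexive (sym eq))
  w₀ = m≤n⇒m≤1+n (≤-reflexive eq) , s≤s (≤-reflexive (sym eq))

-- Induction on the length: make the heads agree, then recurse on the tails, with the window one
-- lower if the head is nonzero.
Window-connected : ∀ {n} s (a b : Tuple k n) → Window s a → Window s b → Star (Move (Window s)) a b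
Window-connected s [] [] _ _ = ε
Window-connected {n = suc n} s (zero ∷ a) (zero ∷ b) (p , q) (p′ , q′) =
  Moves-∷ zero Window-zero (Window-connected s a b (p , q) (p′ , q′))
Window-connected {n = suc n} (suc s) (suc x ∷ a) (suc y ∷ b) (s≤s p , s≤s q) (s≤s p′ , s≤s q′) =
  (Window-suc x (p , q) , Window-suc y (p , q) , 0 , here) ◅
  Moves-∷ (suc y) (Window-suc y) (Window-connected s a b (p , q) (p′ , q′))
Window-connected {n = suc n} s (zero ∷ a) (suc y ∷ b) wa wb
  with s′ , a′ , refl , wa′ , wb′ , moves ← insertNonzero y a b wa wb =
  moves ◅◅ Moves-∷ (suc y) (Window-suc y) (Window-connected s′ a′ b wa′ wb′)
Window-connected {n = suc n} s (suc x ∷ a) (zero ∷ b) wa wb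
  -- Mirror image of the previous case: the moves start from the other word and are reversed.
  with s′ , b′ , refl , wb′ , wa′ , moves ← insertNonzero x b a wb wa =
  Moves-∷ (suc x) (Window-suc x) (Window-connected s′ a b′ wa′ wb′)
  ◅◅ Star.reverse Move-sym moves

-- Eulerian weight ranges

module _ {k m : ℕ} (r s : ℕ) where

  private
    G = H k r s m

  open Subgraph G using (IsEdge)

  IsEdge-resp : ∀ (a b : Tuple k (suc m)) → weight a ≡ weight b → IsEdge a → IsEdge b
  IsEdge-resp a b eq = subst (λ w → r ≤ w × w ≤ s) eq

  rot-closed : ∀ e → IsEdge e → IsEdge (rot e)
  rot-closed (x ∷ a) = IsEdge-resp (x ∷ a) (a ∷ʳ x) (sym (weight-∷ʳ x a))

  open RotationClosed G rot-closed

  -- The top `t` is independent of `s`, so that a single extreme weight can be a window whose other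
  -- weight no word attains.
  Window⇒Eulerian : ∀ t → (∀ a → IsEdge a → Window t a) → (∀ a → Window t a → IsEdge a) → Eulerian G
  Window⇒Eulerian t to from =
    stronglyConnected (λ e f p q → Moves⇒~ (Star.map (Move-map from) (Window-connected t e f (to e p) (to f q)))) , balanced

  -- All tails in the window have weight `w`, so moving the tail under a fixed front letter
  -- preserves the weight of the edge.
  tightTail⇒Eulerian : ∀ t w → (∀ {c : Tuple k m} → Window t c → weight c ≡ w) →
    (∀ a → IsEdge a → ∃[ x ] ∃[ c ] (a ↻ x ∷ c × Window t c)) → Eulerian G
  tightTail⇒Eulerian t w tight front = stronglyConnected conn , balanced
    where
    conn : ∀ e f → IsEdge e → IsEdge f → e ~ f
    conn e f p q with x , c , e↻ , wc ← front e p | y , d , f↻ , wd ← front f q =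
      -- The front letter switches from `x` to `y` for free, since both edges have target `c`.
      ↻⇒~ p e↻ ◅◅ Moves⇒~ (Moves-∷ y edge (Window-connected t c d wc wd)) ◅◅ ↻⇒~˘ q f↻
      where
      edge : ∀ {c′} → Window t c′ → IsEdge (y ∷ c′)
      edge {c′} wc′ = IsEdge-resp f (y ∷ c′) (trans (weight-↻ f↻) (weight-∷-cong y d c′ (trans (tight wd) (sym (tight wc′))))) q

Eulerian-r,r+1 : ∀ k m r → Eulerian (H k r (suc r) m)
Eulerian-r,r+1 k m r = Window⇒Eulerian r (suc r) (suc r)
  (λ _ (p , q) → q , s≤s p) (λ _ (p , q) → ≤-pred q , p)

Eulerian-0 : ∀ k m → Eulerian (H k 0 0 m)
Eulerian-0 k m = Window⇒Eulerian 0 0 0 (λ _ (p , q) → q , z≤n) (λ _ (p , q) → z≤n , p)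

Eulerian-n : ∀ k m → Eulerian (H k (suc m) (suc m) m)
-- The window consists of `m + 1` and `m + 2`, and the latter exceeds the length.
Eulerian-n k m = Window⇒Eulerian (suc m) (suc m) (suc (suc m))
  (λ _ (p , q) → m≤n⇒m≤1+n q , s≤s p) (λ a (p , q) → ≤-pred q , weight≤n a)

Eulerian-1 : ∀ k m → Eulerian (H k 1 1 m)
Eulerian-1 k m = tightTail⇒Eulerian 1 1 0 0 (λ (p , _) → n≤0⇒n≡0 p) front
  where
  front : ∀ a → 1 ≤ weight a × weight a ≤ 1 → ∃[ x ] ∃[ c ] (a ↻ x ∷ c × Window 0 c)
  -- `lower` locates the only nonzero letter; with it in front, the tail `c` is zero.
  front a (p , q) with d , a′ , ch , eq ← lower a (≤-antisym q p)
                    with x , y , c , s , t ← ChangeAt-front d ch =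
    x , c , s , ≤-trans (weight-tail≤ y c) (≤-reflexive (trans (sym (weight-↻ t)) eq)) , z≤n

Eulerian-n-1 : ∀ k m → Eulerian (H (suc (suc k)) m m m)
Eulerian-n-1 k m = tightTail⇒Eulerian m m (suc m) m (λ {c} (_ , q) → ≤-antisym (weight≤n c) (≤-pred q)) front
  where
  front : ∀ a → m ≤ weight a × weight a ≤ m → ∃[ x ] ∃[ c ] (a ↻ x ∷ c × Window (suc m) c)
  -- Raising the only zero gives the full weight `m + 1`, so the tail `c` has no zeros.
  front a (p , q) with d , a′ , ch , eq ← raise a (s≤s q)
                    with x , y , c , s , t ← ChangeAt-front d ch =
    x , c , s , m≤n⇒m≤1+n (weight≤n c) ,
    ≤-trans (s≤s p) (≤-trans (≤-reflexive (trans (sym eq) (weight-↻ t))) (weight-∷≤ y c))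

-- Cyclic rises

nonzero : Fin k → Bool
nonzero zero    = false
nonzero (suc _) = true

rise : Bool → Bool → ℕ
rise false true  = 1
rise false false = 0
rise true  _     = 0

rises : Vec Bool (suc n) → ℕ
rises (x ∷ [])    = 0
rises (x ∷ y ∷ a) = rise x y + rises (y ∷ a)

rises-∷ʳ : ∀ x y (a : Vec Bool n) → rises ((a ∷ʳ x) ∷ʳ y) ≡ rises (a ∷ʳ x) + rise x y
rises-∷ʳ x y []          = +-comm (rise x y) 0
rises-∷ʳ x y (z ∷ [])    = begin
  rise z x + (rise x y + 0) ≡⟨ cong (rise z x +_) (+-comm (rise x y) 0) ⟩
  rise z x + rise x y       ≡⟨ cong (_+ rise x y) (+-comm 0 (rise z x)) ⟩
  rise z x + 0 + rise x y   ∎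
  where open ≡-Reasoning
rises-∷ʳ x y (z ∷ w ∷ a) =
  trans (cong (rise z w +_) (rises-∷ʳ x y (w ∷ a))) (sym (+-assoc (rise z w) _ _))

-- Repeating the head adds the wrap-around pair. The value is the number of cyclic runs of `true`,
-- unless every letter is `true`.
cyclicRises : Vec Bool (suc n) → ℕ
cyclicRises (x ∷ a) = rises (x ∷ (a ∷ʳ x))

-- Rotation moves the pair `x`, `y` from the front of the closed-up word to its end.
cyclicRises-rot : (a : Vec Bool (suc n)) → cyclicRises (rot a) ≡ cyclicRises a
cyclicRises-rot (x ∷ [])    = refl
cyclicRises-rot (x ∷ y ∷ a) = trans (rises-∷ʳ x y (y ∷ a)) (+-comm (rises (y ∷ (a ∷ʳ x))) (rise x y))

tupleRises : Tuple k (suc n) → ℕ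
tupleRises = cyclicRises ∘ Vec.map nonzero

tupleRises-rot : (a : Tuple k (suc n)) → tupleRises (rot a) ≡ tupleRises a
tupleRises-rot (x ∷ a) =
  trans (cong cyclicRises (map-∷ʳ nonzero x a)) (cyclicRises-rot (nonzero x ∷ Vec.map nonzero a))

weight-nonzero : ∀ (x y : Fin k) (a : Tuple k n) → weight (x ∷ a) ≡ weight (y ∷ a) → nonzero x ≡ nonzero y
weight-nonzero zero    zero    a eq = refl
weight-nonzero (suc x) (suc y) a eq = refl
weight-nonzero zero    (suc y) a eq = contradiction (sym eq) 1+n≢n
weight-nonzero (suc x) zero    a eq = contradiction eq 1+n≢n

-- At fixed weight the letter put before a vertex is determined up to its nonzero value, so the
-- invariant of edges descends to vertices.
tupleRises-determined : ∀ (x y : Fin k) (a : Tuple k n) → weight (x ∷ a) ≡ weight (y ∷ a) →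
                        tupleRises (x ∷ a) ≡ tupleRises (y ∷ a)
tupleRises-determined x y a eq = cong (λ b → cyclicRises (b ∷ Vec.map nonzero a)) (weight-nonzero x y a eq)

module _ {k m r : ℕ} where

  open Subgraph (H k r r m) using (_⟶_)

  reachable⇒tupleRises≡ : ∀ {u v} → Star _⟶_ u v → ∀ (x y : Fin k) → weight (x ∷ u) ≡ r → weight (y ∷ v) ≡ r →
                          tupleRises (x ∷ u) ≡ tupleRises (y ∷ v)
  reachable⇒tupleRises≡ {u} ε x y p q = tupleRises-determined x y u (trans p (sym q))
  reachable⇒tupleRises≡ {v = v} ((f@(z ∷ c) , (r≤f , f≤r) , refl , refl) ◅ path) x y p q = begin
    -- Both `x` and `l` complete the source of `f` to weight `r`, and `l ∷ init f` rotates to `f`.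
    tupleRises (x ∷ init f)          ≡⟨ tupleRises-determined x l (init f) (trans p (sym l∷≡r)) ⟩
    tupleRises (l ∷ init f)          ≡⟨ tupleRises-rot (l ∷ init f) ⟨
    tupleRises (init f ∷ʳ l)         ≡⟨ cong tupleRises (init∷ʳlast f) ⟩
    tupleRises f                     ≡⟨ reachable⇒tupleRises≡ path z y f≡r q ⟩
    tupleRises (y ∷ v)               ∎
    where
    open ≡-Reasoning
    l = last f
    f≡r : weight f ≡ r
    f≡r = ≤-antisym f≤r r≤f
    l∷≡r : weight (l ∷ init f) ≡ r
    l∷≡r = trans (sym (weight-∷ʳ l (init f))) (trans (cong weight (init∷ʳlast f)) f≡r)

-- Middle weights

block : ∀ (p n : ℕ) → Tuple (suc (suc k)) n
block zero    n       = replicate n zero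
block (suc p) zero    = []
block (suc p) (suc n) = suc zero ∷ block p n

weight-block : ∀ {p n} → p ≤ n → weight (block {k} p n) ≡ p
weight-block {n = zero}  z≤n     = refl
weight-block {n = suc n} z≤n     = weight-block {n = n} z≤n
weight-block (s≤s p≤n)           = cong suc (weight-block p≤n)

-- The word switches from nonzero to zero once and never back.
rises-block : ∀ (p n : ℕ) → rises (true ∷ (Vec.map nonzero (block {k} p n) ∷ʳ false)) ≡ 0
rises-block {k} (suc p) (suc n) = rises-block {k} p n
rises-block     (suc p) zero    = refl
rises-block {k} zero    n       = go true n
  where
  go : ∀ b n → rises (b ∷ (Vec.map nonzero (replicate n (zero {suc k})) ∷ʳ false)) ≡ 0
  go true  zero    = refl
  go false zero    = refl
  go true  (suc n) = go false n
  go false (suc n) = go false n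

-- Two nonzero letters can be adjacent or separated: the leading zero and one inner zero split them
-- into two cyclic runs. Having both zeros to spare is what `r ≤ m` provides.
¬Eulerian-middle : ∀ k {r m} → r ≤ m → ¬ Eulerian (H (suc (suc k)) (2 + r) (2 + r) (3 + m))
¬Eulerian-middle k {r} {m} r≤m (connected , _) = contradiction one≡two λ ()
  where
  open ≡-Reasoning
  oneBlock twoBlocks : Tuple (suc (suc k)) (3 + m)
  oneBlock  = block (2 + r) (3 + m)
  twoBlocks = suc zero ∷ zero ∷ block (1 + r) (1 + m)
  w₁ : weight (zero ∷ oneBlock) ≡ 2 + r
  w₁ = cong (2 +_) (weight-block (m≤n⇒m≤1+n r≤m))
  w₂ : weight (zero ∷ twoBlocks) ≡ 2 + r
  w₂ = cong (2 +_) (weight-block r≤m)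
  path = connected oneBlock twoBlocks
    (zero ∷ oneBlock , (≤-reflexive (sym w₁) , ≤-reflexive w₁) , inj₂ refl)
    (zero ∷ twoBlocks , (≤-reflexive (sym w₂) , ≤-reflexive w₂) , inj₂ refl)
  one≡two : 1 ≡ 2
  one≡two = begin
    1                             ≡⟨ cong (1 +_) (rises-block {k} (1 + r) (2 + m)) ⟨
    tupleRises (zero ∷ oneBlock)  ≡⟨ reachable⇒tupleRises≡ path zero zero w₁ w₂ ⟩
    tupleRises (zero ∷ twoBlocks) ≡⟨ cong (2 +_) (rises-block {k} r m) ⟩
    2                             ∎

middle : ∀ r m → r ≤ 2 + m →
         (r ≡ 0 ⊎ r ≡ 1 ⊎ r ≡ 1 + m ⊎ r ≡ 2 + m) ⊎ ∃[ r′ ] ∃[ m′ ] (r ≡ 2 + r′ × m ≡ 2 + m′ × r′ ≤ m′)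
middle 0             m r≤ = inj₁ (inj₁ refl)
middle 1             m r≤ = inj₁ (inj₂ (inj₁ refl))
middle (suc (suc r)) m (s≤s (s≤s r≤m)) with r ≟ m | suc r ≟ m
... | yes refl | _        = inj₁ (inj₂ (inj₂ (inj₂ refl)))
... | no _     | yes refl = inj₁ (inj₂ (inj₂ (inj₁ refl)))
-- The two exclusions improve `r ≤ m` to `2 + r ≤ m`, leaving at least two zeros.
... | no r≢m   | no 1+r≢m with ≤∧≢⇒< (≤∧≢⇒< r≤m r≢m) 1+r≢m
...   | s≤s (s≤s r≤m′) = inj₂ (_ , _ , refl , refl , r≤m′)

theorem3p4 : ∀ (k n : ℕ) → 2 ≤ k → 2 ≤ n →
    (∀ (r : ℕ) → r ≤ n →
    Eulerian (H k r r (n ∸ 1)) ⇔ (r ≡ 0 ⊎ r ≡ 1 ⊎ r ≡ n ∸ 1 ⊎ r ≡ n))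
    × (∀ (r : ℕ) → r < n → Eulerian (H k r (suc r) (n ∸ 1)))
theorem3p4 (suc (suc k)) (suc (suc m)) (s≤s (s≤s _)) (s≤s (s≤s _)) =
  (λ r r≤n → mk⇔ (necessary r r≤n) (sufficient r)) , (λ r _ → Eulerian-r,r+1 _ _ r)
  where
  necessary : ∀ r → r ≤ 2 + m → Eulerian (H (2 + k) r r (1 + m)) → r ≡ 0 ⊎ r ≡ 1 ⊎ r ≡ 1 + m ⊎ r ≡ 2 + m
  necessary r r≤n eulerian with middle r m r≤n
  ... | inj₁ extreme                       = extreme
  ... | inj₂ (_ , _ , refl , refl , r′≤m′) = contradiction eulerian (¬Eulerian-middle k r′≤m′)
  sufficient : ∀ r → r ≡ 0 ⊎ r ≡ 1 ⊎ r ≡ 1 + m ⊎ r ≡ 2 + m → Eulerian (H (2 + k) r r (1 + m))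
  sufficient r (inj₁ refl)               = Eulerian-0 _ _
  sufficient r (inj₂ (inj₁ refl))        = Eulerian-1 _ _
  sufficient r (inj₂ (inj₂ (inj₁ refl))) = Eulerian-n-1 _ _
  sufficient r (inj₂ (inj₂ (inj₂ refl))) = Eulerian-n _ _
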